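{- For every abstract computation function $T : \mathbb{N} \to \mathbb{N} \to \mathbb{N} \to \mathrm{option}\,\mathbb{N}$, $\mathsf{WC\text{ - }N} \to \mathsf{CT}_T \to \bot$; i.e. Brouwer's continuity principle $\mathsf{WC\text{ - }N}$ and Church's thesis $\mathsf{CT}_T$ are jointly contradictory.
   Context: Ambient theory: Coq's type theory (constructive, with a hierarchy of types $\mathbb{T}$ and a separate impredicative universe $\mathbb{P}$ of propositions), with no additional axioms. $\exists$ is propositional existence, $\mathbb{L}\,\mathbb{N}$ the type of finite lists of natural numbers, and $\mathrm{map}\,f\,L$ applies $f$ to each entry of the list $L$. An abstract computation function is a function $T : \mathbb{N} \to \mathbb{N} \to \mathbb{N} \to \mathrm{option}\,\mathbb{N}$ (arguments: code $c$, input $x$, step index $n$) that is monotonic: $T\,c\,x\,n_1 = \mathrm{Some}\,y \to \forall n_2 \ge n_1.\; T\,c\,x\,n_2 = \mathrm{Some}\,y$. Define $c \sim f := \forall x.\,\exists n.\; T\,c\,x\,n = \mathrm{Some}(f\,x)$ and $\mathsf{CT}_T := \forall f : \mathbb{N} \to \mathbb{N}.\ \exists c : \mathbb{N}.\ c \sim f$. (The axiom $\mathsf{CT}$ is the case where $T$ is the step-indexed evaluation function of a concrete Turing-complete model of computation.) $\mathsf{WC\text{ - }N} := \forall R : (\mathbb{N} \to \mathbb{N}) \to \mathbb{N} \to \mathbb{P}.\ (\forall f.\,\exists n.\ R\,f\,n) \to \forall f.\,\exists L : \mathbb{L}\,\mathbb{N}.\,\exists n : \mathbb{N}.\ \forall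 g : \mathbb{N} \to \mathbb{N}.\ \mathrm{map}\,f\,L = \mathrm{map}\,g\,L \to R\,g\,n$. -}

module Defs where

open import Data.Irrelevant using (Irrelevant)
open import Data.List.Base using (List; map)
open import Data.Maybe.Base using (Maybe; just)
open import Data.Nat.Base using (ℕ; _≥_)
open import Data.Product.Base as Product using ()
open import Relation.Binary.PropositionalEquality.Core using (_≡_)

-- A proposition is the squash ∥ A ∥ of a type: its inhabitants carry no
-- information and can only be eliminated into other propositions.  Squashing
-- is essential below.  With Σ in place of ∃, WC-N would postulate a modulus of
-- continuity as a function, and is already refutable on its own.

∥_∥ : Set → Set
∥ A ∥ = Irrelevant A

∃ : {A : Set} → (A → Set) → Set
∃ P = ∥ Product.∃ P ∥

infix 2 ∃-syntax

∃-syntax : (A : Set) → (A → Set) → Set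
∃-syntax A P = ∃ P

syntax ∃-syntax A (λ x → P) = ∃[ x ∶ A ] P

Monotonic : (ℕ → ℕ → ℕ → Maybe ℕ) → Set
Monotonic T = ∀ c x n₁ y → T c x n₁ ≡ just y → ∀ n₂ → n₂ ≥ n₁ → T c x n₂ ≡ just y

record AbstractComputationFunction : Set where
  field
    T         : ℕ → ℕ → ℕ → Maybe ℕ
    monotonic : Monotonic T

  infix 4 _∼_

  _∼_ : ℕ → (ℕ → ℕ) → Set
  c ∼ f = ∀ x → ∃[ n ∶ ℕ ] T c x n ≡ just (f x)

  CT : Set
  CT = ∀ (f : ℕ → ℕ) → ∃[ c ∶ ℕ ] c ∼ f

-- The propositional relation is f , n ↦ ∥ R f n ∥; in the premise its squash
-- is absorbed by that of ∃.
WC-N : Set₁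
WC-N = ∀ (R : (ℕ → ℕ) → ℕ → Set) →
       (∀ f → ∃[ n ∶ ℕ ] R f n) →
       ∀ f → ∃[ L ∶ List ℕ ] ∃[ n ∶ ℕ ]
         (∀ (g : ℕ → ℕ) → map f L ≡ map g L → ∥ R g n ∥)

{-# OPTIONS --safe #-}

-- Church's thesis makes "c is a code of f" a total relation.  Continuity at
-- the zero function yields one code c that serves every function vanishing on
-- some finite list, hence both the zero function and x ↦ x ∸ m, where m bounds
-- the list.  These differ at 1 + m, although a code determines its function.
module Submission where

open import Data.Empty using (⊥; ⊥-elim-irr)
open import Data.Irrelevant using ([_])
open import Data.List.Base using (map)
open import Data.List.Extrema.Nat using (max; xs≤max)
open import Data.List.Properties using (map-cong-local)
import Data.List.Relation.Unary.All as All
open import Data.Maybe.Base using (just)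
open import Data.Maybe.Properties using (just-injective)
open import Data.Nat.Base using (suc; _∸_; _⊔_)
open import Data.Nat.Properties using (_≟_; 0≢1+n; m+n∸n≡m; m≤m⊔n; m≤n⊔m; m≤n⇒m∸n≡0)
open import Data.Product.Base using (_,_)
open import Function.Base using (const)
open import Relation.Nullary.Decidable.Core using (decidable-stable)
open import Relation.Binary.PropositionalEquality using (_≡_; refl; sym; trans)
open import Defs

-- Nested squashes cannot be flattened without irrelevant projections, so they
-- are opened only on the way to ⊥, where relevance does not matter.
_>>=_ : ∀ {A} → ∥ A ∥ → (A → ⊥) → ⊥
[ a ] >>= f = ⊥-elim-irr (f a)

module _ (𝒯 : AbstractComputationFunction) where
  open AbstractComputationFunction 𝒯

  -- By monotonicity both results persist to step `n₁ ⊔ n₂`, where `T` has a single value.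
  T-functional : ∀ {c x y₁ y₂} n₁ n₂ →
                 T c x n₁ ≡ just y₁ → T c x n₂ ≡ just y₂ → y₁ ≡ y₂
  T-functional n₁ n₂ eq₁ eq₂ = just-injective (trans
    (sym (monotonic _ _ n₁ _ eq₁ (n₁ ⊔ n₂) (m≤m⊔n n₁ n₂)))
    (monotonic _ _ n₂ _ eq₂ (n₁ ⊔ n₂) (m≤n⊔m n₁ n₂)))

  -- The step indices are squashed, so they can be opened only towards `⊥`. Decidable equality on
  -- `ℕ` is stable, which permits arguing by contradiction.
  ∼-functional : ∀ {c f g} → c ∼ f → c ∼ g → ∀ x → f x ≡ g x
  ∼-functional {f = f} {g} c∼f c∼g x = decidable-stable (f x ≟ g x) λ fx≢gx → do
    n₁ , eq₁ ← c∼f x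
    n₂ , eq₂ ← c∼g x
    fx≢gx (T-functional n₁ n₂ eq₁ eq₂)

-- Subtraction truncates at 0, and `max 0 L` bounds every entry of `L`.
map-∸-max : ∀ L → map (const 0) L ≡ map (_∸ max 0 L) L
map-∸-max L = map-cong-local (All.map (λ x≤m → sym (m≤n⇒m∸n≡0 x≤m)) (xs≤max 0 L))

theorem67 : (𝒯 : AbstractComputationFunction) → WC-N → AbstractComputationFunction.CT 𝒯 → ⊥
theorem67 𝒯 wc-n ct = do
  L , ∃code ← wc-n (λ f c → c ∼ f) ct (const 0)
  c , codes ← ∃code
  -- The base point agrees with itself on `L`.
  c∼0 ← codes (const 0) refl
  c∼∸ ← codes (_∸ max 0 L) (map-∸-max L)
  let 0≡1+m∸m = ∼-functional 𝒯 c∼0 c∼∸ (suc (max 0 L))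
  0≢1+n (trans 0≡1+m∸m (m+n∸n≡m 1 (max 0 L)))
  where open AbstractComputationFunction 𝒯
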